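{- Let $G$ be a connected graph with minimum degree $\delta(G)\geq 3$. If $D$ is a connected $2$-dominating set of $G$ with $|D|\ge 3$, then $rx_3(G)\leq rx_3(G[D])+4$, where $G[D]$ is the subgraph of $G$ induced by $D$. Moreover, the bound is tight: there exist a connected graph $G$ with $\delta(G)\ge 3$ and a connected $2$-dominating set $D$ of $G$ with $|D|\ge 3$ for which $rx_3(G)= rx_3(G[D])+4$.
   Context: All graphs are finite, simple, connected and undirected. Edge colorings are arbitrary (adjacent edges may receive the same color). In an edge-colored graph $G$, a tree $T\subseteq G$ (a subgraph that is a tree) is a rainbow tree if no two edges of $T$ have the same color. For a connected graph $G$ of order $n\ge 3$, a $3$-rainbow coloring of $G$ is an edge coloring such that for every set $S$ of $3$ vertices of $G$ there is a rainbow tree $T$ in $G$ with $S\subseteq V(T)$. The $3$-rainbow index $rx_3(G)$ is the minimum number of colors in a $3$-rainbow coloring of $G$. A set $D\subseteq V(G)$ is a $2$-dominating set if $|N_G(v)\cap D|\geq 2$ for every $v\in V(G)\setminus D$; it is a connected $2$-dominating set if moreover the induced subgraph $G[D]$ is connected. -}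

module Defs where

open import Data.Nat using (ℕ; _≤_)
open import Data.Fin using (Fin)
open import Data.Fin.Subset using (Subset; _∈_; _∉_; _⊆_; _∩_; ∣_∣; Nonempty)
open import Data.Fin.Subset.Properties using (_∈?_)
open import Data.Vec using (tabulate)
open import Data.List using (List; []; _∷_; _∷ʳ_; length)
open import Data.List.Relation.Unary.Linked using (Linked)
open import Data.List.Relation.Unary.Unique.Propositional using (Unique)
open import Data.Product using (Σ; _×_; _,_)
open import Data.Sum using (_⊎_)
open import Level using (0ℓ)
open import Relation.Binary.Core using (Rel)
open import Relation.Binary.Definitions using (Symmetric; Irreflexive; Decidable)
open import Relation.Binary.Construct.Closure.ReflexiveTransitive using (Star)
open import Relation.Binary.PropositionalEquality using (_≡_)
open import Relation.Nullary using (¬_; does; _×-dec_)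

-- The vertex set is a subset of the label set Fin n, so that a graph and all of
-- its subgraphs live in the same type; every finite simple graph is, up to
-- relabelling, of this form.
record Graph (n : ℕ) : Set₁ where
  field
    V        : Subset n
    Adj      : Rel (Fin n) 0ℓ
    adj?     : Decidable Adj
    adj-sym  : Symmetric Adj
    adj-irr  : Irreflexive _≡_ Adj
    adj-V    : ∀ {u v} → Adj u v → u ∈ V

open Graph public

module _ {n : ℕ} where

  N : Graph n → Fin n → Subset n
  N G v = tabulate (λ u → does (adj? G v u))

  degree : Graph n → Fin n → ℕ
  degree G v = ∣ N G v ∣

  MinDegree≥ : ℕ → Graph n → Set
  MinDegree≥ d G = ∀ {v} → v ∈ V G → d ≤ degree G v

  Connected : Graph n → Set
  Connected G = Nonempty (V G) × (∀ {u v} → u ∈ V G → v ∈ V G → Star (Adj G) u v)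

  -- The cycle u, v₁, …, vₘ, u with m ≥ 2 and u, v₁, …, vₘ pairwise distinct.
  IsCycle : Graph n → Fin n → List (Fin n) → Set
  IsCycle G u vs = 2 ≤ length vs × Unique (u ∷ vs) × Linked (Adj G) (u ∷ (vs ∷ʳ u))

  IsTree : Graph n → Set
  IsTree T = Connected T × (∀ u vs → ¬ IsCycle T u vs)

  _IsSubgraphOf_ : Graph n → Graph n → Set
  H IsSubgraphOf G = V H ⊆ V G × (∀ {u v} → Adj H u v → Adj G u v)

  -- G[D]; used only for D ⊆ V G.
  induced : Graph n → Subset n → Graph n
  induced G D = record
    { V       = D
    ; Adj     = λ u v → u ∈ D × v ∈ D × Adj G u v
    ; adj?    = λ u v → (u ∈? D) ×-dec (v ∈? D) ×-dec adj? G u v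
    ; adj-sym = λ (p , q , e) → q , p , adj-sym G e
    ; adj-irr = λ { eq (_ , _ , e) → adj-irr G eq e }
    ; adj-V   = λ (p , _ , _) → p
    }

  -- Colours are attached to all unordered pairs of labels, but only the values
  -- on edges of the graph under consideration are ever inspected.
  record EdgeColoring (k : ℕ) : Set where
    field
      color     : Fin n → Fin n → Fin k
      color-sym : ∀ u v → color u v ≡ color v u

  open EdgeColoring public

  SameEdge : Fin n → Fin n → Fin n → Fin n → Set
  SameEdge u v x y = (u ≡ x × v ≡ y) ⊎ (u ≡ y × v ≡ x)

  Rainbow : ∀ {k} → EdgeColoring k → Graph n → Set
  Rainbow c T = ∀ {u v x y} → Adj T u v → Adj T x y →
                color c u v ≡ color c x y → SameEdge u v x y

  Is3RainbowColoring : ∀ {k} → Graph n → EdgeColoring k → Set₁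
  Is3RainbowColoring G c =
    ∀ (S : Subset n) → S ⊆ V G → ∣ S ∣ ≡ 3 →
    Σ (Graph n) λ T → T IsSubgraphOf G × IsTree T × Rainbow c T × S ⊆ V T

  3RainbowColorable : Graph n → ℕ → Set₁
  3RainbowColorable G k = Σ (EdgeColoring k) λ c → Is3RainbowColoring G c

  -- "rx₃(G) = k".  Meaningful for connected G with at least 3 vertices, where a
  -- least such k exists (giving all edges different colours is a 3-rainbow
  -- coloring) and is unique.
  Rx₃≡ : Graph n → ℕ → Set₁
  Rx₃≡ G k = 3RainbowColorable G k × (∀ j → 3RainbowColorable G j → k ≤ j)

  Is2Dominating : Graph n → Subset n → Set
  Is2Dominating G D =
    D ⊆ V G × (∀ {v} → v ∈ V G → v ∉ D → 2 ≤ ∣ N G v ∩ D ∣)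

  IsConnected2Dominating : Graph n → Subset n → Set
  IsConnected2Dominating G D = Is2Dominating G D × Connected (induced G D)

{-# OPTIONS --safe #-}
-- Upper bound.  Let I be a maximal independent set of G − D.  The s colors of G[D] are extended by
-- four new ones: the edges from D to a vertex of I receive 0, 1, 3, 3, …, those to another vertex
-- outside D receive 0, 3, 3, …, and the edges outside D receive 2.  By the choice of I and by
-- δ(G) ≥ 3, a vertex of I reaches D through color 0, through color 1, and through either color 3
-- alone or color 2 followed by color 3 at a vertex outside D ∪ I; a vertex outside D ∪ I reaches D
-- through color 0, through color 3, and through color 2 followed by color 1 at a vertex of I.
-- Hence three vertices can always be joined to D with disjoint sets of new colors, and a rainbow
-- tree of G[D] on their feet completes the tree.
--
-- Tightness.  Take G = K₃,ₘ with m large and D a 4-cycle in it, so that rx₃(G[D]) = 2.  If few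
-- colors are used, three vertices x₁, x₂, x₃ on the large side see the same three colors.  A rainbow
-- tree containing them uses at most one xᵢ-edge at each vertex p of the small side, so the xᵢ are
-- leaves matched with the p's; each p then needs a second edge to connect its leaf to the rest,
-- which makes six edges.

module Submission where

open import Data.Bool using (Bool; true; false; if_then_else_; _xor_)
import Data.Bool.Properties as Bool
open import Data.Empty using (⊥)
import Data.Fin as Fin
open import Data.Fin
  using ( Fin; zero; suc; _↑ˡ_; _↑ʳ_; splitAt; join; combine; remQuot; punchIn; punchOut
        ; _≟_; _<?_ )
open import Data.Fin.Patterns using (0F; 1F; 2F; 3F; 4F)
open import Data.Fin.Properties
  using ( suc-injective; <⇒≢; <-trans; any?; all?; splitAt-↑ˡ; splitAt-↑ʳ; splitAt-join
        ; ↑ˡ-injective; ↑ʳ-injective; combine-injective; combine-remQuot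
        ; punchInᵢ≢i; punchOut-injective; pigeonhole; injective⇒≤ )
open import Data.Fin.Subset
  using (Subset; inside; outside; ⊤; _∈_; _∉_; _⊆_; _∩_; _∪_; ∁; ⁅_⁆; ∣_∣) renaming (⊥ to ∅)
open import Data.Fin.Subset.Properties
open import Data.List using (List; []; _∷_; _∷ʳ_; map; length)
open import Data.List.Membership.Propositional using (find; lose) renaming (_∈_ to _∈ˡ_; _∉_ to _∉ˡ_)
open import Data.List.Membership.Propositional.Properties using (∈-map⁺; ∈-map⁻)
import Data.List.Membership.DecPropositional as DecMembership
open import Data.List.Properties using (length-map)
open import Data.List.Relation.Unary.All as All using (All; []; _∷_)
open import Data.List.Relation.Unary.All.Properties using (∷ʳ⁺; ¬Any⇒All¬; All¬⇒¬Any)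
open import Data.List.Relation.Unary.AllPairs using ([]; _∷_)
open import Data.List.Relation.Unary.Any as Any using (Any; here; there)
open import Data.List.Relation.Unary.Linked using (Linked; []; [-]; _∷_)
open import Data.List.Relation.Unary.Unique.Propositional using (Unique)
import Data.List.Relation.Unary.Unique.DecPropositional as DecUnique
import Data.List.Relation.Unary.Unique.Propositional.Properties as Unique
open import Data.Nat using (ℕ; zero; suc; _+_; _*_; _≤_; _<_; z≤n; s≤s)
import Data.Nat.Properties as ℕ
open import Data.Product using (Σ; ∃; _×_; _,_; proj₁; proj₂)
open import Data.Sum using (_⊎_; inj₁; inj₂; map₂)
open import Data.Sum.Properties using (inj₁-injective; inj₂-injective)
open import Data.Vec using (Vec; []; _∷_; lookup)
import Data.Vec as Vec
open import Data.Vec.Relation.Unary.All using ([]; _∷_)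
open import Data.Vec.Relation.Unary.AllPairs using ([]; _∷_)
open import Data.Vec.Relation.Unary.Unique.Propositional.Properties using (lookup-injective)
open import Data.Vec.Properties using (lookup∘tabulate; []=⇒lookup)
open import Function using (_∘_; id)
open import Function.Definitions using (Injective)
open import Level using (0ℓ)
open import Relation.Binary.Core using (Rel)
open import Relation.Binary.Construct.Closure.ReflexiveTransitive using (Star; ε; _◅_; _◅◅_; gmap; reverse)
open import Relation.Binary.PropositionalEquality using (_≡_; _≢_; refl; sym; trans; cong; cong₂; subst; ≢-sym)
open import Relation.Nullary using (¬_; Dec; yes; no; does; contradiction; _×-dec_; _⊎-dec_; ¬?)
open import Relation.Nullary.Decidable using (dec-true; dec-false; True; toWitness)
open import Defs

-- Subsets and neighbourhoods

private variable n : ℕ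

elements : Subset n → List (Fin n)
elements []            = []
elements (inside  ∷ p) = zero ∷ map suc (elements p)
elements (outside ∷ p) = map suc (elements p)

length-elements : (p : Subset n) → length (elements p) ≡ ∣ p ∣
length-elements []            = refl
length-elements (inside  ∷ p) = cong suc (trans (length-map suc (elements p)) (length-elements p))
length-elements (outside ∷ p) = trans (length-map suc (elements p)) (length-elements p)

elements-unique : (p : Subset n) → Unique (elements p)
elements-unique []            = []
elements-unique (inside  ∷ p) =
  ¬Any⇒All¬ _ (λ 0∈ → case-zero (∈-map⁻ suc 0∈)) ∷ Unique.map⁺ suc-injective (elements-unique p)
  where
  case-zero : ¬ (∃ λ x → x ∈ˡ elements p × zero ≡ suc x)
  case-zero (_ , _ , ())
elements-unique (outside ∷ p) = Unique.map⁺ suc-injective (elements-unique p)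

∈-elements⁺ : {p : Subset n} {x : Fin n} → x ∈ p → x ∈ˡ elements p
∈-elements⁺ {p = inside  ∷ p} Vec.here        = here refl
∈-elements⁺ {p = inside  ∷ p} (Vec.there x∈p) = there (∈-map⁺ suc (∈-elements⁺ x∈p))
∈-elements⁺ {p = outside ∷ p} (Vec.there x∈p) = ∈-map⁺ suc (∈-elements⁺ x∈p)

∈-elements⁻ : (p : Subset n) {x : Fin n} → x ∈ˡ elements p → x ∈ p
∈-elements⁻ (inside  ∷ p) (here refl) = Vec.here
∈-elements⁻ (inside  ∷ p) (there x∈)  with _ , y∈ , refl ← ∈-map⁻ suc x∈ = Vec.there (∈-elements⁻ p y∈)
∈-elements⁻ (outside ∷ p) x∈          with _ , y∈ , refl ← ∈-map⁻ suc x∈ = Vec.there (∈-elements⁻ p y∈)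

-- Supplies a neighbour outside `D` for a vertex of degree at least 3, and the vertex of the 4-cycle
-- that a triple omits.
∣p∣<∣q∣⇒∃∈q∉p : (p q : Subset n) → ∣ p ∣ < ∣ q ∣ → ∃ λ x → x ∈ q × x ∉ p
∣p∣<∣q∣⇒∃∈q∉p (inside  ∷ p) (inside  ∷ q) (s≤s lt)
  with x , x∈q , x∉p ← ∣p∣<∣q∣⇒∃∈q∉p p q lt = suc x , Vec.there x∈q , x∉p ∘ drop-there
∣p∣<∣q∣⇒∃∈q∉p (outside ∷ p) (inside  ∷ q) lt = zero , Vec.here , λ ()
∣p∣<∣q∣⇒∃∈q∉p (inside  ∷ p) (outside ∷ q) lt
  with x , x∈q , x∉p ← ∣p∣<∣q∣⇒∃∈q∉p p q (ℕ.<⇒≤ lt) = suc x , Vec.there x∈q , x∉p ∘ drop-there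
∣p∣<∣q∣⇒∃∈q∉p (outside ∷ p) (outside ∷ q) lt
  with x , x∈q , x∉p ← ∣p∣<∣q∣⇒∃∈q∉p p q lt = suc x , Vec.there x∈q , x∉p ∘ drop-there

∣p∪q∣≤∣p∣+∣q∣ : (p q : Subset n) → ∣ p ∪ q ∣ ≤ ∣ p ∣ + ∣ q ∣
∣p∪q∣≤∣p∣+∣q∣ []            []            = z≤n
∣p∪q∣≤∣p∣+∣q∣ (inside  ∷ p) (inside  ∷ q) =
  s≤s (ℕ.≤-trans (∣p∪q∣≤∣p∣+∣q∣ p q) (ℕ.+-monoʳ-≤ ∣ p ∣ (ℕ.n≤1+n ∣ q ∣)))
∣p∪q∣≤∣p∣+∣q∣ (inside  ∷ p) (outside ∷ q) = s≤s (∣p∪q∣≤∣p∣+∣q∣ p q)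
∣p∪q∣≤∣p∣+∣q∣ (outside ∷ p) (inside  ∷ q) =
  ℕ.≤-trans (s≤s (∣p∪q∣≤∣p∣+∣q∣ p q)) (ℕ.≤-reflexive (sym (ℕ.+-suc ∣ p ∣ ∣ q ∣)))
∣p∪q∣≤∣p∣+∣q∣ (outside ∷ p) (outside ∷ q) = ∣p∪q∣≤∣p∣+∣q∣ p q

⊆-interpolate : (p q : Subset n) (k : ℕ) → p ⊆ q → ∣ p ∣ ≤ k → k ≤ ∣ q ∣ →
                ∃ λ r → p ⊆ r × r ⊆ q × ∣ r ∣ ≡ k
⊆-interpolate []            []            zero    _   _         _ = [] , id , id , refl
⊆-interpolate (inside  ∷ p) (outside ∷ q) k       p⊆q _         _ with () ← p⊆q Vec.here
⊆-interpolate (inside  ∷ p) (inside  ∷ q) (suc k) p⊆q (s≤s p≤k) (s≤s k≤q)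
  with r , p⊆r , r⊆q , eq ← ⊆-interpolate p q k (drop-∷-⊆ p⊆q) p≤k k≤q =
  inside ∷ r , s⊆s p⊆r , s⊆s r⊆q , cong suc eq
⊆-interpolate (outside ∷ p) (outside ∷ q) k       p⊆q p≤k       k≤q
  with r , p⊆r , r⊆q , eq ← ⊆-interpolate p q k (drop-∷-⊆ p⊆q) p≤k k≤q =
  outside ∷ r , s⊆s p⊆r , s⊆s r⊆q , eq
-- The head of `q` is left out as long as its tail can supply `k` elements; otherwise `k` is exactly
-- the size of the whole second set, which is then the answer.
⊆-interpolate (outside ∷ p) (inside  ∷ q) k       p⊆q p≤k       k≤1+q with k ℕ.≤? ∣ q ∣
... | yes k≤q with r , p⊆r , r⊆q , eq ← ⊆-interpolate p q k (drop-∷-⊆ p⊆q) p≤k k≤q =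
  outside ∷ r , s⊆s p⊆r , out⊆ r⊆q , eq
... | no  k≰q = inside ∷ q , out⊆ (drop-∷-⊆ p⊆q) , id , ℕ.≤-antisym (ℕ.≰⇒> k≰q) k≤1+q

-- The three vertices need not be distinct: a 3-rainbow coloring speaks about sets of exactly three
-- vertices, so coinciding ones are padded with others from `p`.
3-subset : {p : Subset n} {x y z : Fin n} → 3 ≤ ∣ p ∣ → x ∈ p → y ∈ p → z ∈ p →
           ∃ λ r → r ⊆ p × ∣ r ∣ ≡ 3 × x ∈ r × y ∈ r × z ∈ r
3-subset {p = p} {x} {y} {z} 3≤∣p∣ x∈ y∈ z∈ =
  let r , xyz⊆r , r⊆p , ∣r∣≡3 = ⊆-interpolate xyz p 3 xyz⊆p ∣xyz∣≤3 3≤∣p∣ in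
  r , r⊆p , ∣r∣≡3 , xyz⊆r (x∈p∪q⁺ (inj₁ (x∈⁅x⁆ x))) ,
  xyz⊆r (x∈p∪q⁺ {p = ⁅ x ⁆} (inj₂ (x∈p∪q⁺ (inj₁ (x∈⁅x⁆ y))))) ,
  xyz⊆r (x∈p∪q⁺ {p = ⁅ x ⁆} (inj₂ (x∈p∪q⁺ {p = ⁅ y ⁆} (inj₂ (x∈⁅x⁆ z)))))
  where
  xyz : Subset _
  xyz = ⁅ x ⁆ ∪ ⁅ y ⁆ ∪ ⁅ z ⁆
  xyz⊆p : xyz ⊆ p
  xyz⊆p v∈ with x∈p∪q⁻ ⁅ x ⁆ (⁅ y ⁆ ∪ ⁅ z ⁆) v∈
  ... | inj₁ v∈x with refl ← x∈⁅y⁆⇒x≡y x v∈x = x∈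
  ... | inj₂ v∈yz with x∈p∪q⁻ ⁅ y ⁆ ⁅ z ⁆ v∈yz
  ... | inj₁ v∈y with refl ← x∈⁅y⁆⇒x≡y y v∈y = y∈
  ... | inj₂ v∈z with refl ← x∈⁅y⁆⇒x≡y z v∈z = z∈
  ∣xyz∣≤3 : ∣ xyz ∣ ≤ 3
  ∣xyz∣≤3 = begin
    ∣ ⁅ x ⁆ ∪ ⁅ y ⁆ ∪ ⁅ z ⁆ ∣             ≤⟨ ∣p∪q∣≤∣p∣+∣q∣ ⁅ x ⁆ (⁅ y ⁆ ∪ ⁅ z ⁆) ⟩
    ∣ ⁅ x ⁆ ∣ + ∣ ⁅ y ⁆ ∪ ⁅ z ⁆ ∣         ≤⟨ ℕ.+-monoʳ-≤ ∣ ⁅ x ⁆ ∣ (∣p∪q∣≤∣p∣+∣q∣ ⁅ y ⁆ ⁅ z ⁆) ⟩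
    ∣ ⁅ x ⁆ ∣ + (∣ ⁅ y ⁆ ∣ + ∣ ⁅ z ⁆ ∣)   ≡⟨ cong₂ _+_ (∣⁅x⁆∣≡1 x) (cong₂ _+_ (∣⁅x⁆∣≡1 y) (∣⁅x⁆∣≡1 z)) ⟩
    3                                     ∎
    where open ℕ.≤-Reasoning

∈N⁻ : (G : Graph n) {u v : Fin n} → u ∈ N G v → Adj G v u
∈N⁻ G {u} {v} u∈ with adj? G v u | trans (sym (lookup∘tabulate (λ w → does (adj? G v w)) u)) ([]=⇒lookup u∈)
... | yes e | _ = e
... | no  _ | ()

connectedFrom : (G : Graph n) {r : Fin n} → r ∈ V G → (∀ {u} → u ∈ V G → Star (Adj G) u r) → Connected G
connectedFrom G {r} r∈ toRoot =
  (r , r∈) , λ u∈ v∈ → toRoot u∈ ◅◅ reverse (adj-sym G) (toRoot v∈)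

-- Greedy choice: `x` joins unless it already has a neighbour in the set built from `xs`, and in
-- that case this neighbour witnesses maximality at `x`.
maximalIndependent : (G : Graph n) (xs : List (Fin n)) → Σ (List (Fin n)) λ I →
  (∀ {v} → v ∈ˡ I → v ∈ˡ xs) ×
  (∀ {u v} → u ∈ˡ I → v ∈ˡ I → ¬ Adj G u v) ×
  (∀ {u} → u ∈ˡ xs → u ∈ˡ I ⊎ ∃ λ v → v ∈ˡ I × Adj G u v)
maximalIndependent G [] = [] , (λ ()) , (λ ()) , λ ()
maximalIndependent G (x ∷ xs) with maximalIndependent G xs
... | I , I⊆xs , indep , maximal with Any.any? (adj? G x) I
... | yes x~I = I , there ∘ I⊆xs , indep , λ where
  (here refl) → inj₂ (find x~I)
  (there u∈)  → maximal u∈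
... | no  x≁I = x ∷ I , x∷I⊆ , indep′ , maximal′
  where
  x∷I⊆ : ∀ {v} → v ∈ˡ x ∷ I → v ∈ˡ x ∷ xs
  x∷I⊆ (here eq)  = here eq
  x∷I⊆ (there v∈) = there (I⊆xs v∈)
  indep′ : ∀ {u v} → u ∈ˡ x ∷ I → v ∈ˡ x ∷ I → ¬ Adj G u v
  indep′ (here refl) (here refl) e = adj-irr G refl e
  indep′ (here refl) (there v∈)  e = x≁I (lose v∈ e)
  indep′ (there u∈)  (here refl) e = x≁I (lose u∈ (adj-sym G e))
  indep′ (there u∈)  (there v∈)  e = indep u∈ v∈ e
  maximal′ : ∀ {u} → u ∈ˡ x ∷ xs → u ∈ˡ x ∷ I ⊎ ∃ λ v → v ∈ˡ x ∷ I × Adj G u v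
  maximal′ (here eq) = inj₁ (here eq)
  maximal′ (there u∈) with maximal u∈
  ... | inj₁ u∈I           = inj₁ (there u∈I)
  ... | inj₂ (v , v∈I , e) = inj₂ (v , there v∈I , e)

-- Growing trees by leaves

singleton : Fin n → Graph n
singleton x = record
  { V       = ⁅ x ⁆
  ; Adj     = λ _ _ → ⊥
  ; adj?    = λ _ _ → no λ ()
  ; adj-sym = λ ()
  ; adj-irr = λ _ ()
  ; adj-V   = λ ()
  }

singleton-isTree : (x : Fin n) → IsTree (singleton x)
singleton-isTree x = connectedFrom (singleton x) (x∈⁅x⁆ x) toRoot , acyclic
  where
  toRoot : ∀ {u} → u ∈ ⁅ x ⁆ → Star (Adj (singleton x)) u x
  toRoot u∈ with refl ← x∈⁅y⁆⇒x≡y x u∈ = ε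
  acyclic : ∀ u vs → ¬ IsCycle (singleton x) u vs
  acyclic u (_ ∷ _) (_ , _ , () ∷ _)

sameEdge-trans : {u v u′ v′ x f : Fin n} →
                 SameEdge u v x f → SameEdge u′ v′ x f → SameEdge u v u′ v′
sameEdge-trans (inj₁ (refl , refl)) (inj₁ (refl , refl)) = inj₁ (refl , refl)
sameEdge-trans (inj₁ (refl , refl)) (inj₂ (refl , refl)) = inj₂ (refl , refl)
sameEdge-trans (inj₂ (refl , refl)) (inj₁ (refl , refl)) = inj₂ (refl , refl)
sameEdge-trans (inj₂ (refl , refl)) (inj₂ (refl , refl)) = inj₁ (refl , refl)

sameEdge-color : ∀ {k} (c : EdgeColoring {n} k) {u v x y} →
                 SameEdge u v x y → color c u v ≡ color c x y
sameEdge-color c (inj₁ (refl , refl)) = refl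
sameEdge-color c (inj₂ (refl , refl)) = color-sym c _ _

-- Exposes the last step of a closed walk, hidden by `∷ʳ`. For a cycle based at a new leaf it gives
-- the second edge at that leaf.
closing-edge : {R : Rel (Fin n) 0ℓ} (a : Fin n) (as : List (Fin n)) {u : Fin n} →
               Linked R (a ∷ as ∷ʳ u) → ∃ λ w → w ∈ˡ a ∷ as × R w u
closing-edge a []       (e ∷ _) = a , here refl , e
closing-edge a (b ∷ as) (_ ∷ l) with w , w∈ , e ← closing-edge b as l = w , there w∈ , e

module _ (T : Graph n) {x f : Fin n} (x∉ : x ∉ V T) (f∈ : f ∈ V T) where

  private
    x≢f : x ≢ f
    x≢f refl = x∉ f∈

  addLeaf : Graph n
  addLeaf = record
    { V       = V T ∪ ⁅ x ⁆
    ; Adj     = λ u v → Adj T u v ⊎ SameEdge u v x f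
    ; adj?    = λ u v → adj? T u v ⊎-dec ((u ≟ x ×-dec v ≟ f) ⊎-dec (u ≟ f ×-dec v ≟ x))
    ; adj-sym = λ where
        (inj₁ e)              → inj₁ (adj-sym T e)
        (inj₂ (inj₁ (p , q))) → inj₂ (inj₂ (q , p))
        (inj₂ (inj₂ (p , q))) → inj₂ (inj₁ (q , p))
    ; adj-irr = λ where
        eq   (inj₁ e)                    → adj-irr T eq e
        refl (inj₂ (inj₁ (p , q)))       → x≢f (trans (sym p) q)
        refl (inj₂ (inj₂ (p , q)))       → x≢f (trans (sym q) p)
    ; adj-V   = λ where
        (inj₁ e)                 → x∈p∪q⁺ (inj₁ (adj-V T e))
        (inj₂ (inj₁ (refl , _))) → x∈p∪q⁺ (inj₂ (x∈⁅x⁆ x))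
        (inj₂ (inj₂ (refl , _))) → x∈p∪q⁺ (inj₁ f∈)
    }

  addLeaf-old : V T ⊆ V addLeaf
  addLeaf-old v∈ = x∈p∪q⁺ (inj₁ v∈)

  addLeaf-new : x ∈ V addLeaf
  addLeaf-new = x∈p∪q⁺ (inj₂ (x∈⁅x⁆ x))

  addLeaf-∈⁻ : ∀ {v} → v ∈ V addLeaf → v ∈ V T ⊎ v ≡ x
  addLeaf-∈⁻ v∈ with x∈p∪q⁻ (V T) ⁅ x ⁆ v∈
  ... | inj₁ v∈T = inj₁ v∈T
  ... | inj₂ v∈x = inj₂ (x∈⁅y⁆⇒x≡y x v∈x)

  private
    leaf-neighbour : ∀ {w} → Adj addLeaf x w → w ≡ f
    leaf-neighbour (inj₁ e)                 = contradiction (adj-V T e) x∉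
    leaf-neighbour (inj₂ (inj₁ (_ , w≡f)))  = w≡f
    leaf-neighbour (inj₂ (inj₂ (x≡f , _))) = contradiction x≡f x≢f

    leaf-neighbour′ : ∀ {w} → Adj addLeaf w x → w ≡ f
    leaf-neighbour′ e = leaf-neighbour (adj-sym addLeaf e)

    -- The two neighbours of x along the walk would both be f.
    avoid : ∀ {p u} ys → u ≢ x → p ≢ u → Unique (p ∷ ys) → All (u ≢_) ys →
            Linked (Adj addLeaf) (p ∷ ys ∷ʳ u) → All (_≢ x) ys
    avoid [] _ _ _ _ _ = []
    avoid (y ∷ ys) u≢x p≢u _ _ _ with y ≟ x
    avoid (y ∷ [])     u≢x p≢u _ _ (e ∷ e′ ∷ _) | yes refl =
      contradiction (trans (leaf-neighbour′ e) (sym (leaf-neighbour e′))) p≢u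
    avoid (y ∷ z ∷ ys) u≢x p≢u ((_ ∷ p≢z ∷ _) ∷ _) _ (e ∷ e′ ∷ _) | yes refl =
      contradiction (trans (leaf-neighbour′ e) (sym (leaf-neighbour e′))) p≢z
    avoid (y ∷ ys)     u≢x p≢u (_ ∷ uniq) (u≢y ∷ u≢ys) (_ ∷ l) | no y≢x =
      y≢x ∷ avoid ys u≢x (≢-sym u≢y) uniq u≢ys l

    restrict : ∀ {xs} → All (_≢ x) xs → Linked (Adj addLeaf) xs → Linked (Adj T) xs
    restrict _ [] = []
    restrict _ [-] = [-]
    restrict (_   ∷ ps)      (inj₁ e ∷ l)                 = e ∷ restrict ps l
    restrict (p≢x ∷ _)       (inj₂ (inj₁ (p≡x , _)) ∷ _) = contradiction p≡x p≢x
    restrict (_   ∷ q≢x ∷ _) (inj₂ (inj₂ (_ , q≡x)) ∷ _) = contradiction q≡x q≢x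

    -- The only neighbour of `x` is `f`, whereas a cycle enters and leaves a vertex through
    -- different neighbours. So `x` is neither the base, nor the first vertex, nor a later one, and
    -- the cycle already lies in `T`.
    acyclic : (∀ u vs → ¬ IsCycle T u vs) → ∀ u vs → ¬ IsCycle addLeaf u vs
    acyclic noCycle u (_ ∷ []) (s≤s () , _)
    acyclic noCycle u (y ∷ z ∷ zs) (len , uniq@((u≢y ∷ u≢z ∷ u≢zs) ∷ uniq′@(y≢zzs ∷ _)) , l@(e ∷ e′ ∷ l′))
      with u ≟ x
    ... | yes refl with w , w∈ , e″ ← closing-edge z zs l′ =
      All.lookup y≢zzs w∈ (trans (leaf-neighbour e) (sym (leaf-neighbour′ e″)))
    ... | no u≢x with y ≟ x
    ... | yes refl = u≢z (trans (leaf-neighbour′ e) (sym (leaf-neighbour e′)))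
    ... | no y≢x =
      noCycle u (y ∷ z ∷ zs) (len , uniq , restrict (u≢x ∷ y≢x ∷ ∷ʳ⁺ zzs≢x u≢x) l)
      where
      zzs≢x : All (_≢ x) (z ∷ zs)
      zzs≢x = avoid (z ∷ zs) u≢x (≢-sym u≢y) uniq′ (u≢z ∷ u≢zs) (e′ ∷ l′)

  addLeaf-isTree : IsTree T → IsTree addLeaf
  addLeaf-isTree ((_ , conn) , noCycle) =
    connectedFrom addLeaf (addLeaf-old f∈) toRoot , acyclic noCycle
    where
    toRoot : ∀ {u} → u ∈ V addLeaf → Star (Adj addLeaf) u f
    toRoot u∈ with addLeaf-∈⁻ u∈
    ... | inj₁ u∈T  = gmap id inj₁ (conn u∈T f∈)
    ... | inj₂ refl = inj₂ (inj₁ (refl , refl)) ◅ ε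

  addLeaf-subgraph : (G : Graph n) → T IsSubgraphOf G → Adj G x f → addLeaf IsSubgraphOf G
  addLeaf-subgraph G (V⊆ , Adj⊆) x~f = V⊆′ , Adj⊆′
    where
    V⊆′ : V addLeaf ⊆ V G
    V⊆′ v∈ with addLeaf-∈⁻ v∈
    ... | inj₁ v∈T  = V⊆ v∈T
    ... | inj₂ refl = adj-V G x~f
    Adj⊆′ : ∀ {u v} → Adj addLeaf u v → Adj G u v
    Adj⊆′ (inj₁ e)                    = Adj⊆ e
    Adj⊆′ (inj₂ (inj₁ (refl , refl))) = x~f
    Adj⊆′ (inj₂ (inj₂ (refl , refl))) = adj-sym G x~f

  addLeaf-rainbow : ∀ {k} (c : EdgeColoring k) → Rainbow c T →
                    (∀ {u v} → Adj T u v → color c u v ≢ color c x f) → Rainbow c addLeaf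
  addLeaf-rainbow c rainbow fresh (inj₁ e) (inj₁ e′) eq = rainbow e e′ eq
  addLeaf-rainbow c rainbow fresh (inj₁ e) (inj₂ s)  eq =
    contradiction (trans eq (sameEdge-color c s)) (fresh e)
  addLeaf-rainbow c rainbow fresh (inj₂ s) (inj₁ e)  eq =
    contradiction (trans (sym eq) (sameEdge-color c s)) (fresh e)
  addLeaf-rainbow c rainbow fresh (inj₂ s) (inj₂ s′) eq = sameEdge-trans s s′

-- A 3-rainbow coloring from a connected 2-dominating set

-- The implicit argument is filled by evaluating the decision procedure, which settles concrete
-- lists of colors.
distinct : ∀ {n} (as : List (Fin n)) {_ : True (DecUnique.unique? _≟_ as)} → Unique as
distinct as {u} = toWitness u

-- The pattern a, b, c, c, ... along a list of neighbours in `D`. The last clause is a default for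
-- lists with fewer than two entries, which 2-domination excludes for the vertices of `G` outside
-- `D`.
legColor : (a b c : Fin 4) → List (Fin n) → Fin n → Fin 4
legColor a b c (f₁ ∷ f₂ ∷ _) f = if does (f ≟ f₁) then a else if does (f ≟ f₂) then b else c
legColor a b c _             f = a

-- The third color may be missing, but only when `p` has at most two elements; a degree condition
-- can then take over.
legColor-attains : (a b c : Fin 4) (p : Subset n) → 2 ≤ ∣ p ∣ →
  let leg = legColor a b c (elements p) in
  (∃ λ f → f ∈ p × leg f ≡ a) × (∃ λ f → f ∈ p × leg f ≡ b) ×
  (∣ p ∣ ≤ 2 ⊎ ∃ λ f → f ∈ p × leg f ≡ c)
legColor-attains a b c p 2≤ =
  go (elements p) (elements-unique p) (∈-elements⁻ p) (length-elements p) 2≤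
  where
  go : ∀ xs → Unique xs → (∀ {f} → f ∈ˡ xs → f ∈ p) → length xs ≡ ∣ p ∣ → 2 ≤ ∣ p ∣ →
       (∃ λ f → f ∈ p × legColor a b c xs f ≡ a) × (∃ λ f → f ∈ p × legColor a b c xs f ≡ b) ×
       (∣ p ∣ ≤ 2 ⊎ ∃ λ f → f ∈ p × legColor a b c xs f ≡ c)
  go []       _ _ len le = contradiction (subst (2 ≤_) (sym len) le) λ ()
  go (_ ∷ []) _ _ len le = contradiction (subst (2 ≤_) (sym len) le) λ { (s≤s ()) }
  go (f₁ ∷ f₂ ∷ fs) ((f₁≢f₂ ∷ f₁≢fs) ∷ f₂≢fs ∷ _) ⊆p len _ =
    (f₁ , ⊆p (here refl) , first) ,
    (f₂ , ⊆p (there (here refl)) , second) ,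
    rest fs f₁≢fs f₂≢fs (λ f∈ → ⊆p (there (there f∈))) len
    where
    leg : Fin _ → Fin 4
    -- `legColor` inspects only the first two entries, so this agrees by computation with the
    -- coloring for the full list.
    leg = legColor a b c (f₁ ∷ f₂ ∷ [])
    first : leg f₁ ≡ a
    first rewrite dec-true (f₁ ≟ f₁) refl = refl
    second : leg f₂ ≡ b
    second rewrite dec-false (f₂ ≟ f₁) (≢-sym f₁≢f₂) | dec-true (f₂ ≟ f₂) refl = refl
    rest : ∀ fs → All (f₁ ≢_) fs → All (f₂ ≢_) fs → (∀ {f} → f ∈ˡ fs → f ∈ p) →
           length (f₁ ∷ f₂ ∷ fs) ≡ ∣ p ∣ → ∣ p ∣ ≤ 2 ⊎ ∃ λ f → f ∈ p × leg f ≡ c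
    rest []      _ _ _ len = inj₁ (ℕ.≤-reflexive (sym len))
    rest (f ∷ _) (f₁≢f ∷ _) (f₂≢f ∷ _) fs⊆p _ = inj₂ (f , fs⊆p (here refl) , third)
      where
      third : leg f ≡ c
      third rewrite dec-false (f ≟ f₁) (≢-sym f₁≢f) | dec-false (f ≟ f₂) (≢-sym f₂≢f) = refl

-- The extended coloring

module Extension (G : Graph n) (D : Subset n) {s : ℕ} (c : EdgeColoring {n} s) where

  outsiders : List (Fin n)
  outsiders = elements (V G ∩ ∁ D)

  I : List (Fin n)
  I = proj₁ (maximalIndependent G outsiders)

  I⊆outsiders : ∀ {v} → v ∈ˡ I → v ∈ˡ outsiders
  I⊆outsiders = proj₁ (proj₂ (maximalIndependent G outsiders))

  I-independent : ∀ {u v} → u ∈ˡ I → v ∈ˡ I → ¬ Adj G u v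
  I-independent = proj₁ (proj₂ (proj₂ (maximalIndependent G outsiders)))

  I-maximal : ∀ {u} → u ∈ˡ outsiders → u ∈ˡ I ⊎ ∃ λ v → v ∈ˡ I × Adj G u v
  I-maximal = proj₂ (proj₂ (proj₂ (maximalIndependent G outsiders)))

  I-outside : ∀ {v} → v ∈ˡ I → v ∉ D
  I-outside v∈ = x∈∁p⇒x∉p (proj₂ (x∈p∩q⁻ (V G) (∁ D) (∈-elements⁻ _ (I⊆outsiders v∈))))

  I-vertex : ∀ {v} → v ∈ˡ I → v ∈ V G
  I-vertex v∈ = proj₁ (x∈p∩q⁻ (V G) (∁ D) (∈-elements⁻ _ (I⊆outsiders v∈)))

  open DecMembership (_≟_ {n}) using () renaming (_∈?_ to _∈ˡ?_)

  leg : Fin n → Fin n → Fin 4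
  leg v = if does (v ∈ˡ? I) then legColor 0F 1F 3F (elements (N G v ∩ D))
                            else legColor 0F 3F 3F (elements (N G v ∩ D))

  -- The Booleans tell whether the endpoints lie in `D`; as separate arguments they make symmetry a
  -- matter of four cases. The old colors are the first `s`, the new ones the last four.
  extendedColor : Bool → Bool → Fin n → Fin n → Fin (s + 4)
  extendedColor true  true  u v = color c u v ↑ˡ 4
  extendedColor true  false u v = s ↑ʳ leg v u
  extendedColor false true  u v = s ↑ʳ leg u v
  extendedColor false false u v = s ↑ʳ 2F

  extended : EdgeColoring {n} (s + 4)
  extended = record
    { color     = λ u v → extendedColor (does (u ∈? D)) (does (v ∈? D)) u v
    ; color-sym = λ u v → sym′ (does (u ∈? D)) (does (v ∈? D)) u v
    }
    where
    sym′ : ∀ p q u v → extendedColor p q u v ≡ extendedColor q p v u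
    sym′ true  true  u v = cong (_↑ˡ 4) (color-sym c u v)
    sym′ true  false u v = refl
    sym′ false true  u v = refl
    sym′ false false u v = refl

  inner-color : ∀ {u v} → u ∈ D → v ∈ D → color extended u v ≡ color c u v ↑ˡ 4
  inner-color {u} {v} u∈ v∈ rewrite dec-true (u ∈? D) u∈ | dec-true (v ∈? D) v∈ = refl

  leg-color : ∀ {x f} → x ∉ D → f ∈ D → color extended x f ≡ s ↑ʳ leg x f
  leg-color {x} {f} x∉ f∈ rewrite dec-false (x ∈? D) x∉ | dec-true (f ∈? D) f∈ = refl

  outer-color : ∀ {x y} → x ∉ D → y ∉ D → color extended x y ≡ s ↑ʳ 2F
  outer-color {x} {y} x∉ y∉ rewrite dec-false (x ∈? D) x∉ | dec-false (y ∈? D) y∉ = refl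

  ↑ˡ≢↑ʳ : ∀ {a : Fin s} {b : Fin 4} → a ↑ˡ 4 ≢ s ↑ʳ b
  ↑ˡ≢↑ʳ {a} {b} eq with () ← trans (sym (splitAt-↑ˡ s a 4)) (trans (cong (splitAt s) eq) (splitAt-↑ʳ s 4 b))

  -- A tree under construction: arms may end at the vertices of `F`, `W` lists the vertices joined
  -- so far, and `A` the new colors reserved for them. The upper bounds `vertices` and `newColors`
  -- are what makes the next leaf and the next color fresh.
  record RainbowTree (F : Subset n) (W : List (Fin n)) (A : List (Fin 4)) : Set₁ where
    field
      tree      : Graph n
      subgraph  : tree IsSubgraphOf G
      isTree    : IsTree tree
      rainbow   : Rainbow extended tree
      feet      : F ⊆ V tree
      contains  : ∀ {v} → v ∈ˡ W → v ∈ V tree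
      vertices  : ∀ {v} → v ∈ V tree → v ∈ D ⊎ v ∈ˡ W
      newColors : ∀ {u v a} → Adj tree u v → color extended u v ≡ s ↑ʳ a → a ∈ˡ A

  extend : ∀ {F W A x f a} → (R : RainbowTree F W A) → x ∉ D → x ∉ˡ W → f ∈ V (RainbowTree.tree R) →
           Adj G x f → color extended x f ≡ s ↑ʳ a → a ∉ˡ A → RainbowTree F (x ∷ W) (a ∷ A)
  extend {F} {W} {A} {x} {f} {a} R x∉D x∉W f∈ x~f xf≡a a∉A = record
    { tree      = addLeaf tree x∉ f∈
    ; subgraph  = addLeaf-subgraph tree x∉ f∈ G subgraph x~f
    ; isTree    = addLeaf-isTree tree x∉ f∈ isTree
    ; rainbow   = addLeaf-rainbow tree x∉ f∈ extended rainbow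
                    (λ e eq → a∉A (newColors e (trans eq xf≡a)))
    ; feet      = addLeaf-old tree x∉ f∈ ∘ feet
    ; contains  = contains′
    ; vertices  = vertices′
    ; newColors = newColors′
    }
    where
    open RainbowTree R
    x∉ : x ∉ V tree
    x∉ x∈ with vertices x∈
    ... | inj₁ x∈D = x∉D x∈D
    ... | inj₂ x∈W = x∉W x∈W
    contains′ : ∀ {v} → v ∈ˡ x ∷ W → v ∈ V (addLeaf tree x∉ f∈)
    contains′ (here refl) = addLeaf-new tree x∉ f∈
    contains′ (there v∈)  = addLeaf-old tree x∉ f∈ (contains v∈)
    vertices′ : ∀ {v} → v ∈ V (addLeaf tree x∉ f∈) → v ∈ D ⊎ v ∈ˡ x ∷ W
    vertices′ v∈ with addLeaf-∈⁻ tree x∉ f∈ v∈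
    ... | inj₂ refl = inj₂ (here refl)
    ... | inj₁ v∈T with vertices v∈T
    ... | inj₁ v∈D = inj₁ v∈D
    ... | inj₂ v∈W = inj₂ (there v∈W)
    newColors′ : ∀ {u v b} → Adj (addLeaf tree x∉ f∈) u v → color extended u v ≡ s ↑ʳ b → b ∈ˡ a ∷ A
    newColors′ (inj₁ e) eq = there (newColors e eq)
    newColors′ (inj₂ e) eq =
      here (↑ʳ-injective s _ _ (trans (sym eq) (trans (sameEdge-color extended e) xf≡a)))

  -- An arm with at most one edge and foot `f`. A vertex of `D` is its own foot and spends no color,
  -- so it is short for every `a`.
  Short : Fin n → Fin 4 → Set
  Short x a = ∃ λ f → f ∈ D × (x ≡ f ⊎ x ∉ D × Adj G x f × color extended x f ≡ s ↑ʳ a)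

  attach : ∀ {F W A x a} → ((f , _) : Short x a) → f ∈ F → x ∉ˡ W → a ∉ˡ A →
           RainbowTree F W A → RainbowTree F (x ∷ W) (a ∷ A)
  attach (f , _ , inj₂ (x∉D , x~f , xf≡a)) f∈F x∉W a∉A R =
    extend R x∉D x∉W (RainbowTree.feet R f∈F) x~f xf≡a a∉A
  -- The vertex is its own foot: the tree stays the same and only the bounds `W` and `A` grow.
  attach {W = W} (f , f∈D , inj₁ refl) f∈F x∉W a∉A R = record
    { RainbowTree R
    ; contains  = λ { (here refl) → feet f∈F ; (there v∈) → contains v∈ }
    ; vertices  = vertices′
    ; newColors = λ e eq → there (newColors e eq)
    }
    where
    open RainbowTree R
    vertices′ : ∀ {v} → v ∈ V tree → v ∈ D ⊎ v ∈ˡ f ∷ W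
    vertices′ v∈ with vertices v∈
    ... | inj₁ v∈D = inj₁ v∈D
    ... | inj₂ v∈W = inj₂ (there v∈W)

  module _ (D⊆V : D ⊆ V G) (3≤∣D∣ : 3 ≤ ∣ D ∣) (inner : Is3RainbowColoring (induced G D) c) where

    innerTree : (S : Subset n) → S ⊆ D → ∣ S ∣ ≡ 3 → RainbowTree S [] []
    innerTree S S⊆D ∣S∣≡3 with T , (V⊆ , Adj⊆) , isTree , rainbow , S⊆T ← inner S S⊆D ∣S∣≡3 = record
      { tree      = T
      ; subgraph  = D⊆V ∘ V⊆ , proj₂ ∘ proj₂ ∘ Adj⊆
      ; isTree    = isTree
      ; rainbow   = λ e e′ eq → rainbow e e′
          (↑ˡ-injective 4 _ _ (trans (sym (inner-edge T Adj⊆ e)) (trans eq (inner-edge T Adj⊆ e′))))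
      ; feet      = S⊆T
      ; contains  = λ ()
      ; vertices  = inj₁ ∘ V⊆
      ; newColors = λ e eq → contradiction (trans (sym (inner-edge T Adj⊆ e)) eq) ↑ˡ≢↑ʳ
      }
      where
      inner-edge : ∀ T {u v} → (∀ {u v} → Adj T u v → Adj (induced G D) u v) →
                   Adj T u v → color extended u v ≡ color c u v ↑ˡ 4
      inner-edge _ Adj⊆ e with u∈ , v∈ , _ ← Adj⊆ e = inner-color u∈ v∈

    -- The feet, which may coincide, lie in a 3-subset of `D`, on which the coloring of `G[D]`
    -- provides a rainbow tree. The arms are hung on it one at a time, each with a color of its own.
    attachThree : ∀ {x y z a b d} → Unique (x ∷ y ∷ z ∷ []) → Unique (a ∷ b ∷ d ∷ []) →
                  Short x a → Short y b → Short z d →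
                  ∃ λ F → RainbowTree F (x ∷ y ∷ z ∷ []) (a ∷ b ∷ d ∷ [])
    attachThree (x∉ ∷ y∉ ∷ z∉ ∷ []) (a∉ ∷ b∉ ∷ d∉ ∷ []) α@(_ , f∈D , _) β@(_ , g∈D , _) γ@(_ , h∈D , _)
      with F , F⊆D , ∣F∣≡3 , f∈ , g∈ , h∈ ← 3-subset 3≤∣D∣ f∈D g∈D h∈D =
      F , attach α f∈ (All¬⇒¬Any x∉) (All¬⇒¬Any a∉)
         (attach β g∈ (All¬⇒¬Any y∉) (All¬⇒¬Any b∉)
         (attach γ h∈ (All¬⇒¬Any z∉) (All¬⇒¬Any d∉) (innerTree F F⊆D ∣F∣≡3)))

    Connecting : List (Fin n) → Set₁
    Connecting xs = Σ (Graph n) λ T → T IsSubgraphOf G × IsTree T × Rainbow extended T ×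
                    (∀ {v} → v ∈ˡ xs → v ∈ V T)

    direct : ∀ {x y z a b d} → Unique (x ∷ y ∷ z ∷ []) → Unique (a ∷ b ∷ d ∷ []) →
             Short x a → Short y b → Short z d → Connecting (x ∷ y ∷ z ∷ [])
    direct xs as α β γ with _ , R ← attachThree xs as α β γ =
      tree , subgraph , isTree , rainbow , contains
      where open RainbowTree R

    -- An arm of two edges: color 2 to a vertex `y` outside `D`, then color `a` into `D`. The
    -- predicate `P` serves to tell the middle vertex from the other two vertices to be joined.
    Detour : (Fin n → Set) → Fin n → Fin 4 → Set
    Detour P x a = ∃ λ y → P y × x ∉ D × y ∉ D × Adj G x y × Short y a

    -- The middle vertex `w` takes the place of `x` in `attachThree`; afterwards `x` is hung on `w`
    -- by an edge of color 2.
    detour : ∀ {P x y z a b d} → Unique (x ∷ y ∷ z ∷ []) → Unique (2F ∷ a ∷ b ∷ d ∷ []) →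
             (∀ {w} → P w → y ≢ w × z ≢ w) →
             Short y a → Short z b → Detour P x d → Connecting (x ∷ y ∷ z ∷ [])
    detour {x = x} {y} {z} ((x≢y ∷ x≢z ∷ []) ∷ (y≢z ∷ []) ∷ _) ((≢a ∷ ≢b ∷ ≢d ∷ []) ∷ (a≢b ∷ a≢d ∷ []) ∷ (b≢d ∷ []) ∷ _)
      avoids β γ (w , Pw , x∉D , w∉D , x~w , α)
      with y≢w , z≢w ← avoids Pw
      with _ , R ← attachThree ((≢-sym y≢w ∷ ≢-sym z≢w ∷ []) ∷ (y≢z ∷ []) ∷ [] ∷ [])
                               ((≢-sym a≢d ∷ ≢-sym b≢d ∷ []) ∷ (a≢b ∷ []) ∷ [] ∷ []) α β γ =
      tree , subgraph , isTree , rainbow , λ where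
        (here refl) → contains (here refl)
        (there v∈)  → contains (there (there v∈))
      where
      x≢w : x ≢ w
      x≢w eq = adj-irr G eq x~w
      open RainbowTree (extend R x∉D (All¬⇒¬Any (x≢w ∷ x≢y ∷ x≢z ∷ []))
                                (RainbowTree.contains R (here refl)) x~w (outer-color x∉D w∉D)
                                (All¬⇒¬Any (≢d ∷ ≢a ∷ ≢b ∷ [])))

    -- Two kinds of vertices and their arms

    Inner : Fin n → Set
    Inner x = x ∈ D ⊎ x ∈ˡ I

    -- A detour always passes through a vertex of the opposite kind. In a triple of one kind, its
    -- middle vertex therefore differs from the other two members.
    InnerArms OuterArms : Fin n → Set
    InnerArms x = Inner x × Short x 0F × Short x 1F × (Short x 3F ⊎ Detour (¬_ ∘ Inner) x 3F)
    OuterArms x = ¬ Inner x × Short x 0F × Short x 3F × Detour Inner x 1F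

    -- Inner vertices can use 0 or 1 and outer ones 0 or 3, so a mixed triple is served by 0, 1, 3
    -- without detours. In a triple of one kind, two vertices use the two short colors of that kind,
    -- and the first one uses the missing color, directly or after an edge of color 2.
    connect : ∀ {x y z} → Unique (x ∷ y ∷ z ∷ []) → InnerArms x ⊎ OuterArms x →
              InnerArms y ⊎ OuterArms y → InnerArms z ⊎ OuterArms z → Connecting (x ∷ y ∷ z ∷ [])
    connect u (inj₁ (_ , _ , _ , inj₁ x₃)) (inj₁ (_ , y₀ , _)) (inj₁ (_ , _ , z₁ , _)) =
      direct u (distinct (3F ∷ 0F ∷ 1F ∷ [])) x₃ y₀ z₁
    connect u (inj₁ (_ , _ , _ , inj₂ x₃)) (inj₁ (iy , y₀ , _)) (inj₁ (iz , _ , z₁ , _)) =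
      detour u (distinct (2F ∷ 0F ∷ 1F ∷ 3F ∷ []))
        (λ ow → (λ { refl → ow iy }) , λ { refl → ow iz }) y₀ z₁ x₃
    connect u (inj₁ (_ , x₀ , _)) (inj₁ (_ , _ , y₁ , _)) (inj₂ (_ , _ , z₃ , _)) =
      direct u (distinct (0F ∷ 1F ∷ 3F ∷ [])) x₀ y₁ z₃
    connect u (inj₁ (_ , x₀ , _)) (inj₂ (_ , _ , y₃ , _)) (inj₁ (_ , _ , z₁ , _)) =
      direct u (distinct (0F ∷ 3F ∷ 1F ∷ [])) x₀ y₃ z₁
    connect u (inj₂ (_ , _ , x₃ , _)) (inj₁ (_ , y₀ , _)) (inj₁ (_ , _ , z₁ , _)) =
      direct u (distinct (3F ∷ 0F ∷ 1F ∷ [])) x₃ y₀ z₁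
    connect u (inj₁ (_ , _ , x₁ , _)) (inj₂ (_ , y₀ , _)) (inj₂ (_ , _ , z₃ , _)) =
      direct u (distinct (1F ∷ 0F ∷ 3F ∷ [])) x₁ y₀ z₃
    connect u (inj₂ (_ , x₀ , _)) (inj₁ (_ , _ , y₁ , _)) (inj₂ (_ , _ , z₃ , _)) =
      direct u (distinct (0F ∷ 1F ∷ 3F ∷ [])) x₀ y₁ z₃
    connect u (inj₂ (_ , x₀ , _)) (inj₂ (_ , _ , y₃ , _)) (inj₁ (_ , _ , z₁ , _)) =
      direct u (distinct (0F ∷ 3F ∷ 1F ∷ [])) x₀ y₃ z₁
    connect u (inj₂ (_ , _ , _ , x₁)) (inj₂ (oy , y₀ , _)) (inj₂ (oz , _ , z₃ , _)) =
      detour u (distinct (2F ∷ 0F ∷ 3F ∷ 1F ∷ []))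
        (λ iw → (λ { refl → oy iw }) , λ { refl → oz iw }) y₀ z₃ x₁

    module _ (δ≥3 : MinDegree≥ 3 G)
             (dominating : ∀ {v} → v ∈ V G → v ∉ D → 2 ≤ ∣ N G v ∩ D ∣) where

      outsideShort : ∀ {x a} → x ∉ D → (∃ λ f → f ∈ N G x ∩ D × leg x f ≡ a) → Short x a
      outsideShort {x} x∉D (f , f∈ , eq) with f∈N , f∈D ← x∈p∩q⁻ (N G x) D f∈ =
        f , f∈D , inj₂ (x∉D , ∈N⁻ G f∈N , trans (leg-color x∉D f∈D) (cong (s ↑ʳ_) eq))

      leg-I : ∀ {x} → x ∈ˡ I → leg x ≡ legColor 0F 1F 3F (elements (N G x ∩ D))
      leg-I {x} x∈I rewrite dec-true (x ∈ˡ? I) x∈I = refl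

      leg-∉I : ∀ {x} → x ∉ˡ I → leg x ≡ legColor 0F 3F 3F (elements (N G x ∩ D))
      leg-∉I {x} x∉I rewrite dec-false (x ∈ˡ? I) x∉I = refl

      shortI : ∀ {x} → x ∈ˡ I →
               Short x 0F × Short x 1F × (∣ N G x ∩ D ∣ ≤ 2 ⊎ Short x 3F)
      shortI {x} x∈I with legColor-attains 0F 1F 3F (N G x ∩ D) (dominating (I-vertex x∈I) (I-outside x∈I))
      ... | l₀ , l₁ , l₃ rewrite sym (leg-I x∈I) =
        outsideShort (I-outside x∈I) l₀ , outsideShort (I-outside x∈I) l₁ ,
        map₂ (outsideShort (I-outside x∈I)) l₃

      shortO : ∀ {x} → x ∈ V G → x ∉ D → x ∉ˡ I → Short x 0F × Short x 3F
      shortO {x} x∈V x∉D x∉I with legColor-attains 0F 3F 3F (N G x ∩ D) (dominating x∈V x∉D)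
      ... | l₀ , l₃ , _ rewrite sym (leg-∉I x∉I) = outsideShort x∉D l₀ , outsideShort x∉D l₃

      -- If color 3 does not occur between `x` and `D`, at most two neighbours of `x` lie in `D`,
      -- and the minimum degree gives a further neighbour `y`. Independence keeps `y` out of `I`, so
      -- `y` has an edge of color 3 into `D`.
      arms-I : ∀ {x} → x ∈ˡ I → InnerArms x
      arms-I {x} x∈I with shortI x∈I
      ... | s₀ , s₁ , inj₂ s₃ = inj₂ x∈I , s₀ , s₁ , inj₁ s₃
      ... | s₀ , s₁ , inj₁ ≤2
        with y , y∈N , y∉N∩D ← ∣p∣<∣q∣⇒∃∈q∉p (N G x ∩ D) (N G x) (ℕ.≤-trans (s≤s ≤2) (δ≥3 (I-vertex x∈I))) =
        inj₂ x∈I , s₀ , s₁ ,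
        inj₂ (y , (λ { (inj₁ y∈D) → y∉D y∈D ; (inj₂ y∈I) → y∉I y∈I }) ,
              I-outside x∈I , y∉D , x~y , proj₂ (shortO (adj-V G (adj-sym G x~y)) y∉D y∉I))
        where
        x~y : Adj G x y
        x~y = ∈N⁻ G y∈N
        y∉D : y ∉ D
        y∉D y∈D = y∉N∩D (x∈p∩q⁺ (y∈N , y∈D))
        y∉I : y ∉ˡ I
        y∉I y∈I = I-independent x∈I y∈I x~y

      arms : ∀ {x} → x ∈ V G → InnerArms x ⊎ OuterArms x
      arms {x} x∈V = go (x ∈? D) (x ∈ˡ? I)
        where
        go : Dec (x ∈ D) → Dec (x ∈ˡ I) → InnerArms x ⊎ OuterArms x
        go (yes x∈D) _         = inj₁ (inj₁ x∈D , atD , atD , inj₁ atD)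
          where
          atD : ∀ {a} → Short x a
          atD = x , x∈D , inj₁ refl
        go (no x∉D)  (yes x∈I) = inj₁ (arms-I x∈I)
        go (no x∉D)  (no x∉I) with I-maximal (∈-elements⁺ (x∈p∩q⁺ (x∈V , x∉p⇒x∈∁p x∉D)))
        ... | inj₁ x∈I = contradiction x∈I x∉I
        -- Maximality of `I` gives the neighbour `y`, whose edge of color 1 into `D` completes the
        -- detour.
        ... | inj₂ (y , y∈I , x~y) with s₀ , s₃ ← shortO x∈V x∉D x∉I =
          inj₂ ((λ { (inj₁ x∈D) → x∉D x∈D ; (inj₂ x∈I) → x∉I x∈I }) , s₀ , s₃ ,
                y , inj₂ y∈I , x∉D , I-outside y∈I , x~y , proj₁ (proj₂ (shortI y∈I)))

      extended-is3Rainbow : Is3RainbowColoring G extended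
      extended-is3Rainbow S S⊆V ∣S∣≡3 =
        go (elements S) (elements-unique S) ∈-elements⁺ (∈-elements⁻ S) (trans (length-elements S) ∣S∣≡3)
        where
        go : ∀ xs → Unique xs → (∀ {v} → v ∈ S → v ∈ˡ xs) → (∀ {v} → v ∈ˡ xs → v ∈ S) → length xs ≡ 3 →
             Σ (Graph n) λ T → T IsSubgraphOf G × IsTree T × Rainbow extended T × S ⊆ V T
        go (x ∷ y ∷ z ∷ []) uniq S⊆xs xs⊆S refl
          with T , sub , isTree , rainbow , xs⊆T ←
               connect uniq (arms (S⊆V (xs⊆S (here refl)))) (arms (S⊆V (xs⊆S (there (here refl)))))
                            (arms (S⊆V (xs⊆S (there (there (here refl)))))) =
          T , sub , isTree , rainbow , xs⊆T ∘ S⊆xs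

-- Stated for colorability, it yields both the general inequality and the upper bound in the tight
-- example.
colorable+4 : (G : Graph n) → MinDegree≥ 3 G → (D : Subset n) → IsConnected2Dominating G D → 3 ≤ ∣ D ∣ →
              ∀ s → 3RainbowColorable (induced G D) s → 3RainbowColorable G (s + 4)
colorable+4 G δ≥3 D ((D⊆V , dominating) , _) 3≤∣D∣ s (c , inner) =
  extended , extended-is3Rainbow D⊆V 3≤∣D∣ inner δ≥3 dominating
  where open Extension G D c

-- Tightness: the complete bipartite graphs K₃,ₘ

-- Tag every index with whether its value has occurred before: of two indices with the same value
-- and tag, the smaller one is itself preceded by an index with that value.
pigeonhole₃ : ∀ {k} → k + k < n → (f : Fin n → Fin k) →
              Σ (Fin 3 → Fin n) λ x → Injective _≡_ _≡_ x × ∃ λ v → ∀ i → f (x i) ≡ v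
pigeonhole₃ {n} {k} k+k<n f = go (pigeonhole k+k<n (λ i → join k k (tag (repeated? i) (f i))))
  where
  Repeated : Fin n → Set
  Repeated i = ∃ λ j → j Fin.< i × f j ≡ f i
  repeated? : ∀ i → Dec (Repeated i)
  repeated? i = any? λ j → j <? i ×-dec f j ≟ f i
  tag : ∀ {P : Set} → Dec P → Fin k → Fin k ⊎ Fin k
  tag (yes _) = inj₂
  tag (no _)  = inj₁
  triple : ∀ {i j} → i Fin.< j → (r : Dec (Repeated i)) (r′ : Dec (Repeated j)) →
           tag r (f i) ≡ tag r′ (f j) →
           Σ (Fin 3 → Fin n) λ x → Injective _≡_ _≡_ x × ∃ λ v → ∀ i → f (x i) ≡ v
  triple i<j (no _) (no ¬r) eq = contradiction (_ , i<j , inj₁-injective eq) ¬r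
  triple {i} {j} i<j (yes (h , h<i , fh≡fi)) (yes _) eq =
    lookup (h ∷ i ∷ j ∷ []) ,
    lookup-injective ((<⇒≢ h<i ∷ <⇒≢ (<-trans h<i i<j) ∷ []) ∷ (<⇒≢ i<j ∷ []) ∷ [] ∷ []) _ _ ,
    f j , λ where
      0F → trans fh≡fi (inj₂-injective eq)
      1F → inj₂-injective eq
      2F → refl
  go : (∃ λ i → ∃ λ j → i Fin.< j ×
          join k k (tag (repeated? i) (f i)) ≡ join k k (tag (repeated? j) (f j))) →
       Σ (Fin 3 → Fin n) λ x → Injective _≡_ _≡_ x × ∃ λ v → ∀ i → f (x i) ≡ v
  go (i , j , i<j , eq) = triple i<j (repeated? i) (repeated? j)
    (trans (sym (splitAt-join k k (tag (repeated? i) (f i))))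
      (trans (cong (splitAt k) eq) (splitAt-join k k (tag (repeated? j) (f j)))))

side : ∀ {m} → Fin (3 + m) → Bool
side 0F                  = true
side 1F                  = true
side 2F                  = true
side (suc (suc (suc _))) = false

bipartite₃ : ∀ m → Graph (3 + m)
bipartite₃ m = record
  { V       = ⊤
  ; Adj     = λ u v → side u ≢ side v
  ; adj?    = λ u v → ¬? (side u Bool.≟ side v)
  ; adj-sym = ≢-sym
  ; adj-irr = λ u≡v s≢ → s≢ (cong side u≡v)
  ; adj-V   = λ _ → ∈⊤
  }

side-↑ˡ : ∀ {m} (q : Fin 3) → side (q ↑ˡ m) ≡ true
side-↑ˡ 0F = refl
side-↑ˡ 1F = refl
side-↑ˡ 2F = refl

side-true : ∀ {m} (u : Fin (3 + m)) → side u ≡ true → ∃ λ q → u ≡ q ↑ˡ m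
side-true 0F _ = 0F , refl
side-true 1F _ = 1F , refl
side-true 2F _ = 2F , refl

first-step : {A : Set} {R : Rel A 0ℓ} {u v : A} → u ≢ v → Star R u v → ∃ λ w → R u w
first-step u≢v ε       = contradiction refl u≢v
first-step _   (e ◅ _) = _ , e

star-closed : {A : Set} {R : Rel A 0ℓ} {P : A → Set} → (∀ {u v} → P u → R u v → P v) →
              ∀ {u v} → Star R u v → P u → P v
star-closed closed ε       Pu = Pu
star-closed closed (e ◅ s) Pu = star-closed closed s (closed Pu e)

-- If `q` were missed, punching it out would inject `Fin (suc k)` into `Fin k`.
injective⇒surjective : ∀ {k} {f : Fin (suc k) → Fin (suc k)} → Injective _≡_ _≡_ f → ∀ q → ∃ λ i → f i ≡ q
injective⇒surjective {f = f} inj q with any? (λ i → f i ≟ q)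
... | yes i = i
... | no ∄  = contradiction
  (injective⇒≤ {f = λ i → punchOut (missed i)}
    (λ {i} {i′} eq → inj (punchOut-injective (missed i) (missed i′) eq)))
  ℕ.1+n≰n
  where
  missed : ∀ i → q ≢ f i
  missed i q≡fi = ∄ (i , sym q≡fi)

-- Six edges in a rainbow tree through three alike vertices

module SixEdges
  {m j : ℕ} (c : EdgeColoring {3 + m} j) (x : Fin 3 → Fin m) (x-injective : Injective _≡_ _≡_ x)
  (alike : ∀ q i i′ → color c (3 ↑ʳ x i) (q ↑ˡ m) ≡ color c (3 ↑ʳ x i′) (q ↑ˡ m))
  (T : Graph (3 + m)) (T⊆ : T IsSubgraphOf bipartite₃ m) (connected : Connected T) (rainbow : Rainbow c T)
  (x∈T : ∀ i → (3 ↑ʳ x i) ∈ V T) where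

  small : Fin 3 → Fin (3 + m)
  small q = q ↑ˡ m

  leaf : Fin 3 → Fin (3 + m)
  leaf i = 3 ↑ʳ x i

  leaf-injective : ∀ {i i′} → leaf i ≡ leaf i′ → i ≡ i′
  leaf-injective eq = x-injective (↑ʳ-injective 3 _ _ eq)

  small-neighbour : ∀ {i v} → Adj T (leaf i) v → ∃ λ q → v ≡ small q
  small-neighbour {v = v} e = side-true v (≢false (proj₂ T⊆ e))
    where
    ≢false : ∀ {b} → false ≢ b → b ≡ true
    ≢false {true}  _ = refl
    ≢false {false} p = contradiction refl p

  large-neighbour : ∀ {q v} → Adj T (small q) v → side v ≡ false
  large-neighbour {q} {v} e with side v | proj₂ T⊆ e
  ... | false | _ = refl
  ... | true  | p = contradiction (side-↑ˡ q) p

  -- By `alike`, the edges from the three leaves to one small vertex have the same color, so a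
  -- rainbow tree contains at most one of them.
  unique-leaf : ∀ {i i′ q} → Adj T (leaf i) (small q) → Adj T (leaf i′) (small q) → i ≡ i′
  unique-leaf {i} {i′} {q} e e′ with rainbow e e′ (alike q i i′)
  ... | inj₁ (eq , _)  = leaf-injective eq
  ... | inj₂ (eq , eq′) = leaf-injective (trans eq eq′)

  another : (i : Fin 3) → ∃ λ i′ → i′ ≢ i
  another i = punchIn i 0F , punchInᵢ≢i i 0F

  -- `T` is connected and contains a second leaf, so some edge of `T` leaves `leaf i`.
  has-neighbour : ∀ i → ∃ λ q → Adj T (leaf i) (small q)
  has-neighbour i with i′ , i′≢i ← another i
    with v , e ← first-step (λ eq → i′≢i (sym (leaf-injective eq))) (proj₂ connected (x∈T i) (x∈T i′))
    with q , refl ← small-neighbour e = q , e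

  σ : Fin 3 → Fin 3
  σ i = proj₁ (has-neighbour i)

  σ-injective : Injective _≡_ _≡_ σ
  σ-injective {i} {i′} eq =
    unique-leaf (proj₂ (has-neighbour i))
      (subst (λ q → Adj T (leaf i′) (small q)) (sym eq) (proj₂ (has-neighbour i′)))

  matched : ∀ q → ∃ λ i → Adj T (leaf i) (small q)
  matched q with i , refl ← injective⇒surjective σ-injective q = i , proj₂ (has-neighbour i)

  -- Since `σ` is onto, each small neighbour of `leaf i` is `σ a` for some `a`, and `unique-leaf`
  -- identifies `a` with `i`.
  degree-one : ∀ {i q q′} → Adj T (leaf i) (small q) → Adj T (leaf i) (small q′) → q ≡ q′
  degree-one {i} {q} {q′} e e′
    with a , refl ← injective⇒surjective σ-injective q
    with b , refl ← injective⇒surjective σ-injective q′ =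
    cong σ (trans (unique-leaf (proj₂ (has-neighbour a)) e) (unique-leaf e′ (proj₂ (has-neighbour b))))

  elsewhere : ∀ q → ∃ λ w → Adj T (small q) w × ∀ i → w ≢ leaf i
  elsewhere q with any? (λ w → adj? T (small q) w ×-dec all? (λ i → ¬? (w ≟ leaf i)))
  ... | yes found = found
  ... | no ∄ with i , e ← matched q with i′ , i′≢i ← another i =
    contradiction (star-closed closed (proj₂ connected (x∈T i) (x∈T i′)) (inj₂ refl)) escaped
    where
    -- Without such a neighbour, the edge between small q and leaf i is a whole component of T.
    InEdge : Fin (3 + m) → Set
    InEdge v = v ≡ small q ⊎ v ≡ leaf i
    escaped : ¬ InEdge (leaf i′)
    escaped (inj₁ eq) with () ← trans (sym (side-↑ˡ q)) (sym (cong side eq))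
    escaped (inj₂ eq) = i′≢i (leaf-injective eq)
    closed : ∀ {u v} → InEdge u → Adj T u v → InEdge v
    closed {v = v} (inj₁ refl) e′ with any? (λ i → v ≟ leaf i)
    ... | no  ∄i          = contradiction (v , e′ , λ i eq → ∄i (i , eq)) ∄
    ... | yes (a , refl) = inj₂ (cong leaf (unique-leaf (adj-sym T e′) e))
    closed (inj₂ refl) e′ with q′ , refl ← small-neighbour e′ = inj₁ (cong small (degree-one e′ e))

  -- The far ends of two edges at each small vertex, six edges in all: one to its matched leaf, one
  -- to a vertex that is none of the three leaves.
  far : Fin 3 × Fin 2 → Fin (3 + m)
  far (q , 0F) = leaf (proj₁ (matched q))
  far (q , 1F) = proj₁ (elsewhere q)

  far-adj : ∀ ((q , b) : Fin 3 × Fin 2) → Adj T (small q) (far (q , b))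
  far-adj (q , 0F) = adj-sym T (proj₂ (matched q))
  far-adj (q , 1F) = proj₁ (proj₂ (elsewhere q))

  far-injective : ∀ q b b′ → far (q , b) ≡ far (q , b′) → b ≡ b′
  far-injective q 0F 0F _  = refl
  far-injective q 1F 1F _  = refl
  far-injective q 0F 1F eq = contradiction (sym eq) (proj₂ (proj₂ (elsewhere q)) _)
  far-injective q 1F 0F eq = contradiction eq (proj₂ (proj₂ (elsewhere q)) _)

  edgeColor : Fin 3 × Fin 2 → Fin j
  edgeColor e@(q , _) = color c (small q) (far e)

  -- Equal colors in a rainbow tree mean equal edges. The reversed orientation is impossible because
  -- the far ends are on the large side.
  edgeColor-injective : Injective _≡_ _≡_ edgeColor
  edgeColor-injective {q , b} {q′ , b′} eq with rainbow (far-adj (q , b)) (far-adj (q′ , b′)) eq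
  ... | inj₂ (q≡far , _)
    with () ← trans (sym (side-↑ˡ q)) (trans (cong side q≡far) (large-neighbour (far-adj (q′ , b′))))
  ... | inj₁ (q≡q′ , far≡) with refl ← ↑ˡ-injective m q q′ q≡q′ = cong (q ,_) (far-injective q b b′ far≡)

  6≤j : 6 ≤ j
  6≤j = injective⇒≤ {f = edgeColor ∘ remQuot 2} λ {e} {e′} eq →
    trans (sym (combine-remQuot {3} 2 e))
      (trans (cong (λ (q , b) → combine q b) (edgeColor-injective eq)) (combine-remQuot {3} 2 e′))

-- Lower bound by counting color patterns

encode : ∀ {j} → (Fin 3 → Fin j) → Fin (j * (j * j))
encode f = combine (f 0F) (combine (f 1F) (f 2F))

encode-injective : ∀ {j} (f g : Fin 3 → Fin j) → encode f ≡ encode g → ∀ q → f q ≡ g q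
encode-injective f g eq q
  with eq₀ , eq₁₂ ← combine-injective (f 0F) (combine (f 1F) (f 2F)) (g 0F) (combine (g 1F) (g 2F)) eq
  with eq₁ , eq₂ ← combine-injective (f 1F) (f 2F) (g 1F) (g 2F) eq₁₂ with q
... | 0F = eq₀
... | 1F = eq₁
... | 2F = eq₂

spokes : ∀ {m j} → EdgeColoring {3 + m} j → Fin m → Fin 3 → Fin j
spokes {m} c i q = color c (3 ↑ʳ i) (q ↑ˡ m)

-- A large vertex sees one of `j * (j * j)` triples of colors, coded as one number by `encode`. With
-- more than twice as many large vertices, three of them see the same triple.
bipartite₃-lower : ∀ m j → j * (j * j) + j * (j * j) < m → 3RainbowColorable (bipartite₃ m) j → 6 ≤ j
bipartite₃-lower m j large (c , rainbowColoring)
  with x , x-injective , _ , alike ← pigeonhole₃ large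
         (encode ∘ spokes c)
  with S , _ , ∣S∣≡3 , x₀ , x₁ , x₂ ←
         3-subset {p = ⊤} {3 ↑ʳ x 0F} {3 ↑ʳ x 1F} {3 ↑ʳ x 2F}
           (subst (3 ≤_) (sym (∣⊤∣≡n (3 + m))) (s≤s (s≤s (s≤s z≤n)))) ∈⊤ ∈⊤ ∈⊤
  with T , T⊆ , (connected , _) , rainbow , S⊆T ← rainbowColoring S (λ _ → ∈⊤) ∣S∣≡3 =
  SixEdges.6≤j c x x-injective
    (λ q i i′ → encode-injective (spokes c (x i)) (spokes c (x i′)) (trans (alike i) (sym (alike i′))) q)
    T T⊆ connected rainbow λ { 0F → S⊆T x₀ ; 1F → S⊆T x₁ ; 2F → S⊆T x₂ }

-- The dominating 4-cycle and the rainbow indices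

bipartite₃-connected : ∀ k → Connected (bipartite₃ (3 + k))
bipartite₃-connected k = connectedFrom (bipartite₃ (3 + k)) {0F} ∈⊤ λ {u} _ → toRoot u
  where
  toRoot : ∀ u → Star (Adj (bipartite₃ (3 + k))) u 0F
  toRoot 0F                  = ε
  toRoot 1F                  = _◅_ {j = 3F} (λ ()) ((λ ()) ◅ ε)
  toRoot 2F                  = _◅_ {j = 3F} (λ ()) ((λ ()) ◅ ε)
  toRoot (suc (suc (suc _))) = (λ ()) ◅ ε

bipartite₃-minDegree : ∀ k → MinDegree≥ 3 (bipartite₃ (3 + k))
bipartite₃-minDegree k {0F}                  _ = s≤s (s≤s (s≤s z≤n))
bipartite₃-minDegree k {1F}                  _ = s≤s (s≤s (s≤s z≤n))
bipartite₃-minDegree k {2F}                  _ = s≤s (s≤s (s≤s z≤n))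
bipartite₃-minDegree k {suc (suc (suc _))} _ = s≤s (s≤s (s≤s z≤n))

-- The 4-cycle 0 3 1 4.
C₄ : ∀ k → Subset (6 + k)
C₄ k = inside ∷ inside ∷ outside ∷ inside ∷ inside ∷ ∅

C₄-cases : ∀ {k v} → v ∈ C₄ k → v ≡ 0F ⊎ v ≡ 1F ⊎ v ≡ 3F ⊎ v ≡ 4F
C₄-cases Vec.here = inj₁ refl
C₄-cases (Vec.there Vec.here) = inj₂ (inj₁ refl)
C₄-cases (Vec.there (Vec.there (Vec.there Vec.here))) = inj₂ (inj₂ (inj₁ refl))
C₄-cases (Vec.there (Vec.there (Vec.there (Vec.there Vec.here)))) = inj₂ (inj₂ (inj₂ refl))
C₄-cases (Vec.there (Vec.there (Vec.there (Vec.there (Vec.there v∈))))) = contradiction v∈ ∉⊥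

module _ {k : ℕ} where

  0∈C₄ : 0F ∈ C₄ k
  0∈C₄ = Vec.here

  1∈C₄ : 1F ∈ C₄ k
  1∈C₄ = Vec.there Vec.here

  3∈C₄ : 3F ∈ C₄ k
  3∈C₄ = Vec.there (Vec.there (Vec.there Vec.here))

  4∈C₄ : 4F ∈ C₄ k
  4∈C₄ = Vec.there (Vec.there (Vec.there (Vec.there Vec.here)))

∣C₄∣≡4 : ∀ k → ∣ C₄ k ∣ ≡ 4
∣C₄∣≡4 k = cong (4 +_) (∣⊥∣≡0 (suc k))

3≤∣C₄∣ : ∀ k → 3 ≤ ∣ C₄ k ∣
3≤∣C₄∣ k = s≤s (s≤s (s≤s z≤n))

C₄-graph : ∀ k → Graph (6 + k)
C₄-graph k = induced (bipartite₃ (3 + k)) (C₄ k)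

C₄-connected : ∀ k → Connected (C₄-graph k)
C₄-connected k = connectedFrom (C₄-graph k) 0∈C₄ (λ u∈ → toRoot u∈ (C₄-cases u∈))
  where
  toRoot : ∀ {u} → u ∈ C₄ k → u ≡ 0F ⊎ u ≡ 1F ⊎ u ≡ 3F ⊎ u ≡ 4F → Star (Adj (C₄-graph k)) u 0F
  toRoot u∈ (inj₁ refl)               = ε
  toRoot u∈ (inj₂ (inj₁ refl))        = (u∈ , 3∈C₄ , λ ()) ◅ (3∈C₄ , 0∈C₄ , λ ()) ◅ ε
  toRoot u∈ (inj₂ (inj₂ (inj₁ refl))) = (u∈ , 0∈C₄ , λ ()) ◅ ε
  toRoot u∈ (inj₂ (inj₂ (inj₂ refl))) = (u∈ , 0∈C₄ , λ ()) ◅ ε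

C₄-dominating : ∀ k → IsConnected2Dominating (bipartite₃ (3 + k)) (C₄ k)
C₄-dominating k = ((λ _ → ∈⊤) , dominated) , C₄-connected k
  where
  dominated : ∀ {v} → v ∈ ⊤ → v ∉ C₄ k → 2 ≤ ∣ N (bipartite₃ (3 + k)) v ∩ C₄ k ∣
  dominated {0F}                _ v∉ = contradiction 0∈C₄ v∉
  dominated {1F}                _ v∉ = contradiction 1∈C₄ v∉
  -- Vertex 2 is adjacent to 3 and 4, and the large vertices are adjacent to 0 and 1.
  dominated {2F}                _ _  = s≤s (s≤s z≤n)
  dominated {suc (suc (suc _))} _ _  = s≤s (s≤s z≤n)

-- The path u, o, w, obtained from its centre by adding two leaves. Any three vertices of a 4-cycle
-- span such a path.
cherry : ∀ {j} {G : Graph n} (c : EdgeColoring j) {o u w : Fin n} → Adj G u o → Adj G w o →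
         color c u o ≢ color c w o →
         Σ (Graph n) λ T → T IsSubgraphOf G × IsTree T × Rainbow c T × o ∈ V T × u ∈ V T × w ∈ V T
cherry {n} {G = G} c {o} {u} {w} u~o w~o differ =
  addLeaf T₁ w∉ o∈₁ ,
  addLeaf-subgraph T₁ w∉ o∈₁ G (addLeaf-subgraph T₀ u∉ o∈₀ G T₀⊆ u~o) w~o ,
  addLeaf-isTree T₁ w∉ o∈₁ (addLeaf-isTree T₀ u∉ o∈₀ (singleton-isTree o)) ,
  addLeaf-rainbow T₁ w∉ o∈₁ c (addLeaf-rainbow T₀ u∉ o∈₀ c (λ ()) (λ ())) fresh ,
  addLeaf-old T₁ w∉ o∈₁ o∈₁ , addLeaf-old T₁ w∉ o∈₁ (addLeaf-new T₀ u∉ o∈₀) , addLeaf-new T₁ w∉ o∈₁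
  where
  T₀ : Graph n
  T₀ = singleton o
  o∈₀ : o ∈ V T₀
  o∈₀ = x∈⁅x⁆ o
  T₀⊆ : T₀ IsSubgraphOf G
  T₀⊆ = (λ v∈ → subst (_∈ V G) (sym (x∈⁅y⁆⇒x≡y o v∈)) (adj-V G (adj-sym G u~o))) , λ ()
  u∉ : u ∉ V T₀
  u∉ u∈ = adj-irr G (x∈⁅y⁆⇒x≡y o u∈) u~o
  T₁ : Graph n
  T₁ = addLeaf T₀ u∉ o∈₀
  o∈₁ : o ∈ V T₁
  o∈₁ = addLeaf-old T₀ u∉ o∈₀ o∈₀
  w∉ : w ∉ V T₁
  w∉ w∈ with addLeaf-∈⁻ T₀ u∉ o∈₀ w∈
  ... | inj₁ w∈₀  = adj-irr G (x∈⁅y⁆⇒x≡y o w∈₀) w~o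
  ... | inj₂ refl = differ refl
  fresh : ∀ {a b} → Adj T₁ a b → color c a b ≢ color c w o
  fresh (inj₂ e) eq = differ (trans (sym (sameEdge-color c e)) eq)

-- A proper edge coloring of the 4-cycle: 0 3 and 1 4 against 0 4 and 1 3.
C₄-coloring : ∀ k → EdgeColoring {6 + k} 2
C₄-coloring k = record
  { color     = λ u v → if hue u xor hue v then 1F else 0F
  ; color-sym = λ u v → cong (if_then 1F else 0F) (Bool.xor-comm (hue u) (hue v))
  }
  where
  hue : Fin (6 + k) → Bool
  hue 1F = true
  hue 4F = true
  hue _  = false

-- A triple omits one vertex of the cycle and is covered by the path centred at the opposite vertex,
-- whose two edges differ in color because the coloring is proper.
C₄-colorable : ∀ k → 3RainbowColorable (C₄-graph k) 2
C₄-colorable k = C₄-coloring k , trees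
  where
  c : EdgeColoring 2
  c = C₄-coloring k
  trees : Is3RainbowColoring (C₄-graph k) c
  trees S S⊆ ∣S∣≡3
    with e , e∈ , e∉S ← ∣p∣<∣q∣⇒∃∈q∉p S (C₄ k) (ℕ.≤-reflexive (trans (cong suc ∣S∣≡3) (sym (∣C₄∣≡4 k)))) =
    go (C₄-cases e∈) e∉S
    where
    cover : ∀ {o u w} → Adj (C₄-graph k) u o → Adj (C₄-graph k) w o → color c u o ≢ color c w o →
            (∀ {v} → v ∈ S → v ≡ o ⊎ v ≡ u ⊎ v ≡ w) →
            Σ (Graph (6 + k)) λ T → T IsSubgraphOf C₄-graph k × IsTree T × Rainbow c T × S ⊆ V T
    cover u~o w~o differ S-cases
      with T , sub , isTree , rainbow , o∈ , u∈ , w∈ ← cherry {G = C₄-graph k} c u~o w~o differ =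
      T , sub , isTree , rainbow , λ v∈ → covered (S-cases v∈)
      where
      covered : ∀ {v} → v ≡ _ ⊎ v ≡ _ ⊎ v ≡ _ → v ∈ V T
      covered (inj₁ refl)        = o∈
      covered (inj₂ (inj₁ refl)) = u∈
      covered (inj₂ (inj₂ refl)) = w∈
    go : ∀ {e} → e ≡ 0F ⊎ e ≡ 1F ⊎ e ≡ 3F ⊎ e ≡ 4F → e ∉ S →
         Σ (Graph (6 + k)) λ T → T IsSubgraphOf C₄-graph k × IsTree T × Rainbow c T × S ⊆ V T
    go (inj₁ refl) e∉S =
      cover {1F} {3F} {4F} (3∈C₄ , 1∈C₄ , λ ()) (4∈C₄ , 1∈C₄ , λ ()) (λ ()) λ v∈ → cases v∈ (C₄-cases (S⊆ v∈))
      where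
      cases : ∀ {v} → v ∈ S → v ≡ 0F ⊎ v ≡ 1F ⊎ v ≡ 3F ⊎ v ≡ 4F → v ≡ 1F ⊎ v ≡ 3F ⊎ v ≡ 4F
      cases v∈ (inj₁ refl) = contradiction v∈ e∉S
      cases v∈ (inj₂ rest) = rest
    go (inj₂ (inj₁ refl)) e∉S =
      cover {0F} {3F} {4F} (3∈C₄ , 0∈C₄ , λ ()) (4∈C₄ , 0∈C₄ , λ ()) (λ ()) λ v∈ → cases v∈ (C₄-cases (S⊆ v∈))
      where
      cases : ∀ {v} → v ∈ S → v ≡ 0F ⊎ v ≡ 1F ⊎ v ≡ 3F ⊎ v ≡ 4F → v ≡ 0F ⊎ v ≡ 3F ⊎ v ≡ 4F
      cases v∈ (inj₁ eq)          = inj₁ eq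
      cases v∈ (inj₂ (inj₁ refl)) = contradiction v∈ e∉S
      cases v∈ (inj₂ (inj₂ rest)) = inj₂ rest
    go (inj₂ (inj₂ (inj₁ refl))) e∉S =
      cover {4F} {0F} {1F} (0∈C₄ , 4∈C₄ , λ ()) (1∈C₄ , 4∈C₄ , λ ()) (λ ()) λ v∈ → cases v∈ (C₄-cases (S⊆ v∈))
      where
      cases : ∀ {v} → v ∈ S → v ≡ 0F ⊎ v ≡ 1F ⊎ v ≡ 3F ⊎ v ≡ 4F → v ≡ 4F ⊎ v ≡ 0F ⊎ v ≡ 1F
      cases v∈ (inj₁ eq)                 = inj₂ (inj₁ eq)
      cases v∈ (inj₂ (inj₁ eq))          = inj₂ (inj₂ eq)
      cases v∈ (inj₂ (inj₂ (inj₁ refl))) = contradiction v∈ e∉S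
      cases v∈ (inj₂ (inj₂ (inj₂ eq)))   = inj₁ eq
    go (inj₂ (inj₂ (inj₂ refl))) e∉S =
      cover {3F} {0F} {1F} (0∈C₄ , 3∈C₄ , λ ()) (1∈C₄ , 3∈C₄ , λ ()) (λ ()) λ v∈ → cases v∈ (C₄-cases (S⊆ v∈))
      where
      cases : ∀ {v} → v ∈ S → v ≡ 0F ⊎ v ≡ 1F ⊎ v ≡ 3F ⊎ v ≡ 4F → v ≡ 3F ⊎ v ≡ 0F ⊎ v ≡ 1F
      cases v∈ (inj₁ eq)                 = inj₂ (inj₁ eq)
      cases v∈ (inj₂ (inj₁ eq))          = inj₂ (inj₂ eq)
      cases v∈ (inj₂ (inj₂ (inj₁ eq)))   = inj₁ eq
      cases v∈ (inj₂ (inj₂ (inj₂ refl))) = contradiction v∈ e∉S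

Fin1-unique : (a b : Fin 1) → a ≡ b
Fin1-unique 0F 0F = refl

-- With a single color a rainbow tree has at most one edge. In a tree containing 0 and 1, the edges
-- leaving these vertices would coincide and join them, but both are on the small side.
C₄-lower : ∀ k j → 3RainbowColorable (C₄-graph k) j → 2 ≤ j
C₄-lower k 0 (c , _) with () ← color c 0F 0F
C₄-lower k (suc (suc j)) _ = s≤s (s≤s z≤n)
C₄-lower k 1 (c , rainbowColoring)
  with S , S⊆ , ∣S∣≡3 , 0∈S , 1∈S , _ ←
         3-subset {p = C₄ k} (3≤∣C₄∣ k) 0∈C₄ 1∈C₄ 1∈C₄
  with T , (_ , T⊆) , ((_ , conn) , _) , rainbow , S⊆T ← rainbowColoring S S⊆ ∣S∣≡3
  with u , e ← first-step (λ ()) (conn (S⊆T 0∈S) (S⊆T 1∈S))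
  with v , e′ ← first-step (λ ()) (conn (S⊆T 1∈S) (S⊆T 0∈S))
  with rainbow e e′ (Fin1-unique _ _)
... | inj₁ (() , _)
... | inj₂ (refl , _) = contradiction refl (proj₂ (proj₂ (T⊆ e′)))

-- At most five colors give at most 125 triples, and 250 is twice that number. The value 6 is the
-- two colors of the 4-cycle plus four.
bipartite₃-rx₃ : ∀ k → 250 < 3 + k → Rx₃≡ (bipartite₃ (3 + k)) 6
bipartite₃-rx₃ k large =
  colorable+4 (bipartite₃ (3 + k)) (bipartite₃-minDegree k) (C₄ k) (C₄-dominating k)
    (3≤∣C₄∣ k) 2 (C₄-colorable k) , lower
  where
  lower : ∀ j → 3RainbowColorable (bipartite₃ (3 + k)) j → 6 ≤ j
  lower j colorable with j ℕ.≤? 5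
  ... | no  j≰5 = ℕ.≰⇒> j≰5
  ... | yes j≤5 = bipartite₃-lower (3 + k) j (ℕ.≤-<-trans (ℕ.+-mono-≤ j³≤125 j³≤125) large) colorable
    where
    j³≤125 : j * (j * j) ≤ 125
    j³≤125 = ℕ.*-mono-≤ j≤5 (ℕ.*-mono-≤ j≤5 j≤5)

theorem2p1 : (∀ (n : ℕ) (G : Graph n) → Connected G → MinDegree≥ 3 G →
    ∀ (D : Subset n) → IsConnected2Dominating G D → 3 ≤ ∣ D ∣ →
    ∀ (r s : ℕ) → Rx₃≡ G r → Rx₃≡ (induced G D) s → r ≤ s + 4)
    ×
    (Σ ℕ λ n → Σ (Graph n) λ G → Σ (Subset n) λ D →
    Connected G × MinDegree≥ 3 G × IsConnected2Dominating G D × 3 ≤ ∣ D ∣ ×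
    (Σ ℕ λ s → Rx₃≡ (induced G D) s × Rx₃≡ G (s + 4)))
theorem2p1 =
  (λ n G _ δ≥3 D dominating 3≤∣D∣ r s (_ , r-least) (colorable , _) →
     r-least (s + 4) (colorable+4 G δ≥3 D dominating 3≤∣D∣ s colorable)) ,
  6 + k , bipartite₃ (3 + k) , C₄ k ,
  bipartite₃-connected k , bipartite₃-minDegree k , C₄-dominating k , 3≤∣C₄∣ k ,
  2 , (C₄-colorable k , C₄-lower k) , bipartite₃-rx₃ k ℕ.≤-refl
  where
  k : ℕ
  -- The least choice for which the large side, of size `3 + k`, has more than 250 vertices.
  k = 248
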